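{- Let $\{z_S^c\}$, $\{x_u^c\}$, $\{x_{uv}^c\}$ be a feasible solution of the chromatic cluster LP. Then for all distinct $u,v,w\in V$ and all $c\in L$, $$x_{uv}^c+x_{vw}^c\ \ge\ x_{wu}^c+x_v^c .$$
   Context: Let $V$ be a finite vertex set, $L$ a finite set of colors, $\gamma\notin L$, and $\phi:\binom V2\to L\cup\{\gamma\}$. The chromatic cluster LP has variables $z_S^c$ ($\emptyset\ne S\subseteq V$, $c\in L$), $x_u^c$ ($u\in V$, $c\in L$), $x_{uv}^c$ ($uv\in\binom V2$, $c\in L$): minimize $\sum_{\phi(uv)\in L}x_{uv}^{\phi(uv)}+\sum_{\phi(uv)=\gamma}\sum_{c\in L}(1-x_{uv}^c)$ subject to $\sum_{S\ni u}z_S^c=1-x_u^c$ for all $u\in V,c\in L$; $\sum_{c\in L}(1-x_u^c)=1$ for all $u\in V$; $\sum_{S\supseteq\{u,v\}}z_S^c=1-x_{uv}^c$ for all $uv\in\binom V2,c\in L$; and $z_S^c\ge0$ for all $S,c$. -}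

module Defs where

open import Algebra.Apartness.Bundles using (HeytingField)
open import Algebra.Apartness.Structures using (IsHeytingField)
open import Algebra.Core using (Op₁; Op₂)
open import Data.Fin.Base using (Fin; zero; suc)
open import Data.Fin.Subset
  using (Subset; inside; outside; ⁅_⁆; _∪_; _⊆_; ∣_∣; Nonempty)
open import Data.Fin.Subset.Properties
  using (_∈?_; _⊆?_; nonempty?; ∣⁅x⁆∣≡1; ∪-identityˡ; ∪-identityʳ)
open import Data.Irrelevant using ([_])
open import Data.List.Base
  using (List; []; _∷_; _++_; map; filter; foldr; mapMaybe; allFin)
open import Data.Maybe.Base using (Maybe; just; nothing)
open import Data.Nat.Base using (ℕ; zero; suc)
open import Data.Nat.Properties using (_≟_)
open import Data.Refinement.Base using (Refinement-syntax; value; _,_)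
open import Data.Sum.Base using (_⊎_)
open import Data.Vec.Base using ([]; _∷_)
open import Level using (_⊔_) renaming (suc to lsuc)
open import Relation.Binary.Core using (Rel)
open import Relation.Binary.PropositionalEquality
  using (_≡_; _≢_; refl; cong; trans)
open import Relation.Binary.Structures using (IsStrictPartialOrder)
open import Relation.Nullary using (¬_; yes; no; contradiction)
open import Relation.Unary using (Decidable)

-- The library has no real numbers, so the LP takes values in an arbitrary
-- ordered field.  The axioms are the constructive ones: apartness is
-- "x < y or y < x", and _≤_ is the negation of the reversed _<_.  Both ℝ
-- (classical or constructive) and ℚ satisfy them.  Cotransitivity of _<_
-- follows from that of apartness, and 0# < 1# from the invertibility of 1#.
record OrderedField a ℓ₁ ℓ₂ : Set (lsuc (a ⊔ ℓ₁ ⊔ ℓ₂)) where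
  infix  8 -_
  infixl 7 _*_
  infixl 6 _+_
  infix  4 _≈_ _<_ _#_ _≤_ _≥_
  field
    Carrier : Set a
    _≈_     : Rel Carrier ℓ₁
    _<_     : Rel Carrier ℓ₂
    _+_     : Op₂ Carrier
    _*_     : Op₂ Carrier
    -_      : Op₁ Carrier
    0#      : Carrier
    1#      : Carrier

  _#_ : Rel Carrier ℓ₂
  x # y = x < y ⊎ y < x

  _≤_ : Rel Carrier ℓ₂
  x ≤ y = ¬ (y < x)

  _≥_ : Rel Carrier ℓ₂
  x ≥ y = y ≤ x

  field
    isHeytingField         : IsHeytingField _≈_ _#_ _+_ _*_ -_ 0# 1#
    <-isStrictPartialOrder : IsStrictPartialOrder _≈_ _<_
    +-monoʳ-<              : ∀ x {y z} → y < z → x + y < x + z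
    *-pos                  : ∀ {x y} → 0# < x → 0# < y → 0# < x * y

  heytingField : HeytingField a ℓ₁ ℓ₂
  heytingField = record { isHeytingField = isHeytingField }

  open IsHeytingField isHeytingField public

NonemptySubset : ℕ → Set
NonemptySubset n = [ S ∈ Subset n ∣ Nonempty S ]

Pair : ℕ → Set
Pair n = [ e ∈ Subset n ∣ ∣ e ∣ ≡ 2 ]

∣⁅u⁆∪⁅v⁆∣≡2 : ∀ {n} (u v : Fin n) → u ≢ v → ∣ ⁅ u ⁆ ∪ ⁅ v ⁆ ∣ ≡ 2
∣⁅u⁆∪⁅v⁆∣≡2 zero    zero    u≢v = contradiction refl u≢v
∣⁅u⁆∪⁅v⁆∣≡2 zero (suc v) _ =
  cong suc (trans (cong ∣_∣ (∪-identityˡ ⁅ v ⁆)) (∣⁅x⁆∣≡1 v))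
∣⁅u⁆∪⁅v⁆∣≡2 (suc u) zero _ =
  cong suc (trans (cong ∣_∣ (∪-identityʳ ⁅ u ⁆)) (∣⁅x⁆∣≡1 u))
∣⁅u⁆∪⁅v⁆∣≡2 (suc u) (suc v) u≢v = ∣⁅u⁆∪⁅v⁆∣≡2 u v λ u≡v → u≢v (cong suc u≡v)

pair : ∀ {n} (u v : Fin n) → u ≢ v → Pair n
pair u v u≢v = ⁅ u ⁆ ∪ ⁅ v ⁆ , [ ∣⁅u⁆∪⁅v⁆∣≡2 u v u≢v ]

allSubsets : ∀ n → List (Subset n)
allSubsets zero    = [] ∷ []
allSubsets (suc n) = map (outside ∷_) (allSubsets n) ++ map (inside ∷_) (allSubsets n)

module _ {a p} {A : Set a} {P : A → Set p} (P? : Decidable P) where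

  refine? : A → Maybe [ x ∈ A ∣ P x ]
  refine? x with P? x
  ... | yes px = just (x , [ px ])
  ... | no  _  = nothing

nonemptySubsets : ∀ n → List (NonemptySubset n)
nonemptySubsets n = mapMaybe (refine? nonempty?) (allSubsets n)

allPairs : ∀ n → List (Pair n)
allPairs n = mapMaybe (refine? λ e → ∣ e ∣ ≟ 2) (allSubsets n)

-- The extra colour γ is represented by nothing, a colour c ∈ L by just c.
record Instance : Set where
  field
    ∣V∣ : ℕ
    ∣L∣ : ℕ

  V : Set
  V = Fin ∣V∣

  L : Set
  L = Fin ∣L∣

  field
    φ : Pair ∣V∣ → Maybe L

-- Two-element sets index x_{uv}^c, so that uv = vu needs no symmetry condition.
record Variables {a ℓ₁ ℓ₂} (F : OrderedField a ℓ₁ ℓ₂) (I : Instance) : Set a where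
  open OrderedField F using (Carrier)
  open Instance I
  field
    z  : NonemptySubset ∣V∣ → L → Carrier
    xᵥ : V → L → Carrier
    xₑ : Pair ∣V∣ → L → Carrier

module _ {a ℓ₁ ℓ₂} {F : OrderedField a ℓ₁ ℓ₂} {I : Instance} where
  open OrderedField F
  open Instance I

  ∑ : ∀ {b} {B : Set b} → List B → (B → Carrier) → Carrier
  ∑ xs f = foldr _+_ 0# (map f xs)

  record Feasible (s : Variables F I) : Set (ℓ₁ ⊔ ℓ₂) where
    open Variables s
    field
      vertex-mass : ∀ (u : V) (c : L) →
        ∑ (filter (λ S → u ∈? value S) (nonemptySubsets ∣V∣)) (λ S → z S c)
          ≈ 1# - xᵥ u c
      vertex-total : ∀ (u : V) → ∑ (allFin ∣L∣) (λ c → 1# - xᵥ u c) ≈ 1#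
      pair-mass : ∀ (e : Pair ∣V∣) (c : L) →
        ∑ (filter (λ S → value e ⊆? value S) (nonemptySubsets ∣V∣)) (λ S → z S c)
          ≈ 1# - xₑ e c
      z-nonneg : ∀ (S : NonemptySubset ∣V∣) (c : L) → z S c ≥ 0#

  objective : Variables F I → Carrier
  objective s = ∑ (allPairs ∣V∣) cost
    where
    open Variables s
    cost : Pair ∣V∣ → Carrier
    cost e with φ e
    ... | just c  = xₑ e c
    ... | nothing = ∑ (allFin ∣L∣) (λ c → 1# - xₑ e c)

{-# OPTIONS --safe #-}

-- Write μ(P) for the z^c-mass of the sets S satisfying P.  In terms of masses
-- the claim reads μ(u,v ∈ S) + μ(v,w ∈ S) ≤ μ(w,u ∈ S) + μ(v ∈ S).  By
-- modularity the left side is the mass of the disjunction plus that of the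
-- conjunction; the disjunction implies v ∈ S, the conjunction implies
-- w,u ∈ S, and μ is monotone because z ≥ 0.
module Submission where

open import Defs
open import Relation.Binary.PropositionalEquality using (_≢_)

import Algebra.Properties.AbelianGroup as AbelianGroupProperties
import Algebra.Properties.CommutativeSemigroup as CommutativeSemigroupProperties
open import Algebra.Bundles using (CommutativeRing)
open import Data.Fin.Base using (Fin)
open import Data.Fin.Subset using (Subset; _∈_; _⊆_; ⁅_⁆; _∪_)
open import Data.Fin.Subset.Properties
  using (_∈?_; _⊆?_; x∈⁅x⁆; x∈⁅y⁆⇒x≡y; p⊆p∪q; q⊆p∪q; x∈p∪q⁻)
open import Data.List.Base using (List; []; _∷_; filter)
open import Data.Product.Base using (_×_; _,_; proj₁; proj₂)
open import Data.Refinement.Base using (value)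
open import Data.Sum.Base using (_⊎_; inj₁; inj₂; [_,_]′)
open import Function.Base using (_∘_)
open import Relation.Binary.PropositionalEquality using (refl)
open import Relation.Binary.Structures using (IsStrictPartialOrder)
open import Relation.Nullary using (yes; no; contradiction)
import Relation.Unary as Unary
open import Relation.Unary.Properties using (_∪?_; _∩?_)

⁅u⁆∪⁅v⁆⊆p⁻ : ∀ {n} (u v : Fin n) {p : Subset n} → ⁅ u ⁆ ∪ ⁅ v ⁆ ⊆ p → u ∈ p × v ∈ p
⁅u⁆∪⁅v⁆⊆p⁻ u v uv⊆p = uv⊆p (p⊆p∪q ⁅ v ⁆ (x∈⁅x⁆ u)) , uv⊆p (q⊆p∪q ⁅ u ⁆ ⁅ v ⁆ (x∈⁅x⁆ v))

⁅u⁆∪⁅v⁆⊆p⁺ : ∀ {n} (u v : Fin n) {p : Subset n} → u ∈ p → v ∈ p → ⁅ u ⁆ ∪ ⁅ v ⁆ ⊆ p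
⁅u⁆∪⁅v⁆⊆p⁺ u v u∈p v∈p x∈uv with x∈p∪q⁻ ⁅ u ⁆ ⁅ v ⁆ x∈uv
... | inj₁ x∈u with refl ← x∈⁅y⁆⇒x≡y u x∈u = u∈p
... | inj₂ x∈v with refl ← x∈⁅y⁆⇒x≡y v x∈v = v∈p

module OrderedFieldProperties {a ℓ₁ ℓ₂} (F : OrderedField a ℓ₁ ℓ₂) where
  open OrderedField F renaming (refl to ≈-refl)

  commutativeRing : CommutativeRing a ℓ₁
  commutativeRing = record { isCommutativeRing = isCommutativeRing }

  open CommutativeRing commutativeRing using (+-abelianGroup; +-commutativeSemigroup)
  open AbelianGroupProperties +-abelianGroup using (⁻¹-∙-comm; //-rightDividesˡ)
  open CommutativeSemigroupProperties +-commutativeSemigroup using (interchange; x∙yz≈y∙xz)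
  open IsStrictPartialOrder <-isStrictPartialOrder
    using (<-respˡ-≈; <-respʳ-≈) renaming (trans to <-trans; irrefl to <-irrefl)

  -- Apartness is `<` in one of the two directions, so cotransitivity of `#` leaves four cases. When
  -- `z` falls outside the interval, below `x` or above `y`, transitivity with `x<y` supplies the
  -- other comparison.
  <-cotrans : ∀ {x y} → x < y → ∀ z → x < z ⊎ z < y
  <-cotrans x<y z with #-cotrans (inj₁ x<y) z
  ... | inj₁ (inj₁ x<z) = inj₁ x<z
  ... | inj₁ (inj₂ z<x) = inj₂ (<-trans z<x x<y)
  ... | inj₂ (inj₁ z<y) = inj₂ z<y
  ... | inj₂ (inj₂ y<z) = inj₁ (<-trans x<y y<z)

  <-resp₂-≈ : ∀ {x x′ y y′} → x ≈ x′ → y ≈ y′ → x < y → x′ < y′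
  <-resp₂-≈ x≈x′ y≈y′ x<y = <-respˡ-≈ x≈x′ (<-respʳ-≈ y≈y′ x<y)

  ≤-refl : ∀ {x} → x ≤ x
  ≤-refl = <-irrefl ≈-refl

  ≤-resp₂-≈ : ∀ {x x′ y y′} → x ≈ x′ → y ≈ y′ → x ≤ y → x′ ≤ y′
  ≤-resp₂-≈ x≈x′ y≈y′ x≤y y′<x′ = x≤y (<-resp₂-≈ (sym y≈y′) (sym x≈x′) y′<x′)

  +-cancelˡ-< : ∀ x {y z} → x + y < x + z → y < z
  +-cancelˡ-< x {y} {z} x+y<x+z =
    <-resp₂-≈ (-x+[x+w]≈w y) (-x+[x+w]≈w z) (+-monoʳ-< (- x) x+y<x+z)
    where
    -x+[x+w]≈w : ∀ w → - x + (x + w) ≈ w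
    -x+[x+w]≈w w = trans (sym (+-assoc (- x) x w)) (trans (+-congʳ (-‿inverseˡ x)) (+-identityˡ w))

  -- Since `≤` is a negated `<`, a violation `x + z < w + y` has to be refuted. Cotransitivity at
  -- the intermediate value `x + y` changes one summand at a time, and cancelling the common summand
  -- contradicts one of the two hypotheses.
  +-mono-≤ : ∀ {w x y z} → w ≤ x → y ≤ z → w + y ≤ x + z
  +-mono-≤ {w} {x} {y} {z} w≤x y≤z x+z<w+y with <-cotrans x+z<w+y (x + y)
  ... | inj₁ x+z<x+y = y≤z (+-cancelˡ-< x x+z<x+y)
  ... | inj₂ x+y<w+y = w≤x (+-cancelˡ-< y (<-resp₂-≈ (+-comm x y) (+-comm w y) x+y<w+y))

  neg-antimono-< : ∀ {x y} → x < y → - y < - x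
  neg-antimono-< {x} {y} x<y = <-resp₂-≈
    (//-rightDividesˡ x (- y))
    (trans (+-congʳ (+-comm (- y) (- x))) (//-rightDividesˡ y (- x)))
    -- Adding `- y - x` cancels `x` on the left, leaving `- y`, and `y` on the right, leaving `- x`.
    (+-monoʳ-< (- y - x) x<y)

  [k-x]+[l-y]≈[k+l]-[x+y] : ∀ k l x y → (k - x) + (l - y) ≈ (k + l) - (x + y)
  [k-x]+[l-y]≈[k+l]-[x+y] k l x y =
    trans (interchange k (- x) l (- y)) (+-congˡ (⁻¹-∙-comm x y))

  -- Carries an inequality between masses over to the LP variables: with `k` equal to `1#`, the
  -- constraints present each mass as a complement `1# - x`, and taking complements reverses the
  -- order.
  complement-cancel-≤ : ∀ k {w x y z} →
    (k - w) + (k - x) ≤ (k - y) + (k - z) → y + z ≤ w + x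
  complement-cancel-≤ k {w} {x} {y} {z} h w+x<y+z = h (<-resp₂-≈
    (sym ([k-x]+[l-y]≈[k+l]-[x+y] k k y z))
    (sym ([k-x]+[l-y]≈[k+l]-[x+y] k k w x))
    (+-monoʳ-< (k + k) (neg-antimono-< w+x<y+z)))

  module _ (I : Instance) {b} {B : Set b} (f : B → Carrier) where

    mass : ∀ {p} {P : B → Set p} → Unary.Decidable P → List B → Carrier
    mass P? xs = ∑ {F = F} {I = I} (filter P? xs) f

    module _ {p q} {P : B → Set p} {Q : B → Set q}
             (P? : Unary.Decidable P) (Q? : Unary.Decidable Q) where

      -- The head contributes equally often to both sides: twice, once or not at all. Deciding
      -- `P? x` and `Q? x` also settles the filters for the union and the intersection, so each case
      -- is a rearrangement around the induction hypothesis.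
      mass-modular : ∀ xs → mass P? xs + mass Q? xs ≈ mass (P? ∪? Q?) xs + mass (P? ∩? Q?) xs
      mass-modular [] = ≈-refl
      mass-modular (x ∷ xs) with P? x | Q? x
      ... | yes _ | yes _ = trans (interchange _ _ _ _)
                              (trans (+-congˡ (mass-modular xs)) (sym (interchange _ _ _ _)))
      ... | yes _ | no  _ = trans (+-assoc _ _ _)
                              (trans (+-congˡ (mass-modular xs)) (sym (+-assoc _ _ _)))
      ... | no  _ | yes _ = trans (x∙yz≈y∙xz _ _ _)
                              (trans (+-congˡ (mass-modular xs)) (sym (+-assoc _ _ _)))
      ... | no  _ | no  _ = mass-modular xs

      mass-mono : (∀ x → 0# ≤ f x) → P Unary.⊆ Q → ∀ xs → mass P? xs ≤ mass Q? xs
      mass-mono 0≤f P⊆Q [] = ≤-refl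
      mass-mono 0≤f P⊆Q (x ∷ xs) with P? x | Q? x
      ... | yes _  | yes _  = +-mono-≤ ≤-refl (mass-mono 0≤f P⊆Q xs)
      ... | yes px | no ¬qx = contradiction (P⊆Q px) ¬qx
      -- Only the larger mass counts the head; the smaller one is padded with `0#`, which `0≤f x`
      -- compares with `f x`.
      ... | no  _  | yes _  = ≤-resp₂-≈ (+-identityˡ _) ≈-refl
                                (+-mono-≤ (0≤f x) (mass-mono 0≤f P⊆Q xs))
      ... | no  _  | no  _  = mass-mono 0≤f P⊆Q xs

mainTheorem2 :
    ∀ {a ℓ₁ ℓ₂} (F : OrderedField a ℓ₁ ℓ₂) (I : Instance) →
    let open OrderedField F
        open Instance I
    in (s : Variables F I) → Feasible s →
    let open Variables s
    in (u v w : V) (u≢v : u ≢ v) (v≢w : v ≢ w) (w≢u : w ≢ u) (c : L) →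
       xₑ (pair u v u≢v) c + xₑ (pair v w v≢w) c ≥ xₑ (pair w u w≢u) c + xᵥ v c
mainTheorem2 F I s feasible u v w u≢v v≢w w≢u c =
  complement-cancel-≤ 1# (≤-resp₂-≈
    (trans (sym (mass-modular I z^c uv? vw? subsets))
      (+-cong (pair-mass (pair u v u≢v) c) (pair-mass (pair v w v≢w) c)))
    -- The disjunction is bounded by the mass at `v` and the conjunction by that at `wu`; the swap
    -- restores the order of the summands in the claim.
    (trans (+-comm _ _) (+-cong (pair-mass (pair w u w≢u) c) (vertex-mass v c)))
    (+-mono-≤
      (mass-mono I z^c (uv? ∪? vw?) v? 0≤z^c
        [ proj₂ ∘ ⁅u⁆∪⁅v⁆⊆p⁻ u v , proj₁ ∘ ⁅u⁆∪⁅v⁆⊆p⁻ v w ]′ subsets)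
      (mass-mono I z^c (uv? ∩? vw?) wu? 0≤z^c
        (λ (uv⊆S , vw⊆S) → ⁅u⁆∪⁅v⁆⊆p⁺ w u
          (proj₂ (⁅u⁆∪⁅v⁆⊆p⁻ v w vw⊆S)) (proj₁ (⁅u⁆∪⁅v⁆⊆p⁻ u v uv⊆S))) subsets)))
  where
  open OrderedField F using (Carrier; _≤_; 0#; 1#; sym; trans; +-cong; +-comm)
  open OrderedFieldProperties F
  open Instance I
  open Variables s
  open Feasible feasible

  subsets : List (NonemptySubset ∣V∣)
  subsets = nonemptySubsets ∣V∣

  z^c : NonemptySubset ∣V∣ → Carrier
  z^c S = z S c

  0≤z^c : ∀ S → 0# ≤ z^c S
  0≤z^c S = z-nonneg S c

  v? : Unary.Decidable (λ S → v ∈ value S)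
  v? S = v ∈? value S

  uv? : Unary.Decidable (λ S → ⁅ u ⁆ ∪ ⁅ v ⁆ ⊆ value S)
  uv? S = ⁅ u ⁆ ∪ ⁅ v ⁆ ⊆? value S

  vw? : Unary.Decidable (λ S → ⁅ v ⁆ ∪ ⁅ w ⁆ ⊆ value S)
  vw? S = ⁅ v ⁆ ∪ ⁅ w ⁆ ⊆? value S

  wu? : Unary.Decidable (λ S → ⁅ w ⁆ ∪ ⁅ u ⁆ ⊆ value S)
  wu? S = ⁅ w ⁆ ∪ ⁅ u ⁆ ⊆? value S
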